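{- Let $t\in\mathcal T_\lambda$. (1) If $t$ is an $\mathtt n$-normal form (there is no $t'$ with $t\to_{\mathtt n}t'$), then $t^{\mathsf{cbn}}$ is $\mathtt w$-normal (there is no $t'$ with $t^{\mathsf{cbn}}\to_{\mathtt w}t'$). (2) If $t$ is a $\mathtt v$-normal form (there is no $t'$ with $t\to_{\mathtt v}t'$), then $t^{\mathsf{cbv}}$ is $\mathtt w$-normal.
   Context: Source terms $\mathcal T_\lambda$: $t,u ::= v\mid t\,u\mid t[x\backslash u]$, with values $v ::= x\mid\lambda x.t$. Target terms ($\lambda!$-calculus): $t,u ::= x \mid t\,u \mid \lambda x.t \mid {!t} \mid \mathrm{der}\,t \mid t[x\backslash u]$. Here $[x\backslash u]$ is a syntactic explicit substitution; $\lambda x.t$ and $t[x\backslash u]$ bind $x$ in $t$; terms are modulo $\alpha$-conversion; $t\{x\backslash u\}$ is capture-avoiding meta-level substitution. List contexts (in both languages): $L ::= \Box\mid L[x\backslash t]$; $C\langle t\rangle$ plugs $t$ in the hole of $C$. Source reductions (rules avoid capture): $\mathtt{dB}$: $L\langle\lambda x.t\rangle\,u\mapsto L\langle t[x\backslash u]\rangle$; $\mathtt{s}$: $t[x\backslash u]\mapsto t\{x\backslash u\}$; $\mathtt{sv}$: $t[x\backslash L\langle v\rangle]\mapsto L\langle t\{x\backslash v\}\rangle$ ($v$ a value). $\to_{\mathtt n}$ is the closure of $\mathtt{dB}$ and $\mathtt s$ under contexts $N ::= \Box\mid N\,t\mid\lambda x.N\mid N[x\backslash u]$. $\to_{\mathtt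 v}$ is the closure of $\mathtt{dB}$ and $\mathtt{sv}$ under contexts $V ::= \Box\mid V\,t\mid t\,V\mid V[x\backslash u]\mid t[x\backslash V]$. Target reduction: $\to_{\mathtt w}$ is the closure, under weak contexts $W ::= \Box \mid W\,t \mid t\,W \mid \lambda x.W \mid \mathrm{der}\,W \mid W[x\backslash u] \mid t[x\backslash W]$, of the rules (avoiding capture) $\mathtt{dB}$: $L\langle\lambda x.t\rangle\,u \mapsto L\langle t[x\backslash u]\rangle$; $\mathtt{s!}$: $t[x\backslash L\langle !u\rangle] \mapsto L\langle t\{x\backslash u\}\rangle$; $\mathtt{d!}$: $\mathrm{der}(L\langle !t\rangle)\mapsto L\langle t\rangle$. Embeddings: $x^{\mathsf{cbn}}=x$, $(\lambda x.t)^{\mathsf{cbn}}=\lambda x.t^{\mathsf{cbn}}$, $(t\,u)^{\mathsf{cbn}}=t^{\mathsf{cbn}}\,{!u^{\mathsf{cbn}}}$, $(t[x\backslash u])^{\mathsf{cbn}}=t^{\mathsf{cbn}}[x\backslash{!u^{\mathsf{cbn}}}]$; $x^{\mathsf{cbv}}={!x}$, $(\lambda x.t)^{\mathsf{cbv}}={!(\lambda x.t^{\mathsf{cbv}})}$, $(t\,u)^{\mathsf{cbv}}=L\langle s\rangle\,u^{\mathsf{cbv}}$ if $t^{\mathsf{cbv}}=L\langle{!s}\rangle$ for some list context $L$ and term $s$, and $(t\,u)^{\mathsf{cbv}}=\mathrm{der}(t^{\mathsf{cbv}})\,u^{\mathsf{cbv}}$ otherwise; $(t[x\backslash u])^{\mathsf{cbv}}=t^{\mathsf{cbv}}[x\backslash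 u^{\mathsf{cbv}}]$. -}

module Defs where

open import Data.Fin.Base using (Fin; zero; suc)
open import Data.Fin.Substitution
open import Data.Nat.Base using (ℕ; zero; suc)
open import Data.Vec.Base using (lookup)
open import Level using (0ℓ)
open import Relation.Binary.Construct.Union using (_∪_)
open import Relation.Binary.Core using (Rel)
open import Relation.Binary.PropositionalEquality using (_≡_; refl; cong)
open import Relation.Nullary using (Dec; yes; no)

private
  variable
    m n : ℕ

-- Terms modulo α-conversion are represented by well-scoped de Bruijn terms:
-- Term n has its free variables in Fin n.  A context of type Ctx n m is a
-- context with free variables in Fin n whose hole lies in scope Fin m, so that
-- plugging captures the m ∸ n variables bound by the context.

module ListContexts (Term : ℕ → Set)
                    (es : ∀ {n} → Term (suc n) → Term n → Term n) where

  infixl 9 _[↦_]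
  infix  10 _⟨_⟩

  data LCtx : ℕ → ℕ → Set where
    □     : LCtx n n
    _[↦_] : LCtx (suc n) m → Term n → LCtx n m

  _⟨_⟩ : LCtx n m → Term m → Term n
  □          ⟨ t ⟩ = t
  (L [↦ u ]) ⟨ t ⟩ = es (L ⟨ t ⟩) u

  -- The renaming that moves a term from outside L into its hole without
  -- capture; this is how "rules avoid capture" is enforced.
  shift : LCtx n m → Sub Fin n m
  shift □          = VarSubst.id
  shift (L [↦ u ]) = VarSubst._⊙_ VarSubst.wk (shift L)

module ContextClosure
  (Term : ℕ → Set) (Ctx : ℕ → ℕ → Set)
  (plug : ∀ {n m} → Ctx n m → Term m → Term n) where

  data Closure (R : ∀ {m} → Rel (Term m) 0ℓ) {n} : Rel (Term n) 0ℓ where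
    close : ∀ {m} (C : Ctx n m) {t t′ : Term m} →
            R t t′ → Closure R (plug C t) (plug C t′)

module Source where

  infixl 7 _·_
  infix  6 ƛ_
  infixl 9 _[↦_]

  data Term (n : ℕ) : Set where
    var   : Fin n → Term n
    ƛ_    : Term (suc n) → Term n
    _·_   : Term n → Term n → Term n
    _[↦_] : Term (suc n) → Term n → Term n

  data Value {n : ℕ} : Term n → Set where
    var : (x : Fin n) → Value (var x)
    ƛ_  : (t : Term (suc n)) → Value (ƛ t)

  module _ {T : ℕ → Set} (l : Lift T Term) where
    open Lift l using (_↑; lift)

    apply : Term m → Sub T m n → Term n
    apply (var x)    ρ = lift (lookup ρ x)
    apply (ƛ t)      ρ = ƛ apply t (ρ ↑)
    apply (t · u)    ρ = apply t ρ · apply u ρ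
    apply (t [↦ u ]) ρ = apply t (ρ ↑) [↦ apply u ρ ]

  termSubst : TermSubst Term
  termSubst = record { var = var ; app = apply }

  open TermSubst termSubst public using (_/Var_; _/_; sub)

  open ListContexts Term _[↦_] public

  infix 4 _↦dB_ _↦s_ _↦sv_ _→n_ _→v_

  data _↦dB_ {n} : Rel (Term n) 0ℓ where
    dB : ∀ {m} (L : LCtx n m) (t : Term (suc m)) (u : Term n) →
         L ⟨ ƛ t ⟩ · u ↦dB L ⟨ t [↦ u /Var shift L ] ⟩

  data _↦s_ {n} : Rel (Term n) 0ℓ where
    s : (t : Term (suc n)) (u : Term n) → t [↦ u ] ↦s t / sub u

  data _↦sv_ {n} : Rel (Term n) 0ℓ where
    sv : ∀ {m} (t : Term (suc n)) (L : LCtx n m) {v : Term m} → Value v →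
         t [↦ L ⟨ v ⟩ ] ↦sv L ⟨ (t /Var (shift L VarSubst.↑)) / sub v ⟩

  data NCtx : ℕ → ℕ → Set where
    □     : NCtx n n
    _·_   : NCtx n m → Term n → NCtx n m
    ƛ_    : NCtx (suc n) m → NCtx n m
    _[↦_] : NCtx (suc n) m → Term n → NCtx n m

  plugN : NCtx n m → Term m → Term n
  plugN □          t = t
  plugN (N · u)    t = plugN N t · u
  plugN (ƛ N)      t = ƛ plugN N t
  plugN (N [↦ u ]) t = plugN N t [↦ u ]

  data VCtx : ℕ → ℕ → Set where
    □      : VCtx n n
    _·ˡ_   : VCtx n m → Term n → VCtx n m
    _·ʳ_   : Term n → VCtx n m → VCtx n m
    _[↦_]ˡ : VCtx (suc n) m → Term n → VCtx n m
    _[↦_]ʳ : Term (suc n) → VCtx n m → VCtx n m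

  plugV : VCtx n m → Term m → Term n
  plugV □           t = t
  plugV (V ·ˡ u)    t = plugV V t · u
  plugV (u ·ʳ V)    t = u · plugV V t
  plugV (V [↦ u ]ˡ) t = plugV V t [↦ u ]
  plugV (u [↦ V ]ʳ) t = u [↦ plugV V t ]

  _→n_ : Rel (Term n) 0ℓ
  _→n_ = ContextClosure.Closure Term NCtx plugN (_↦dB_ ∪ _↦s_)

  _→v_ : Rel (Term n) 0ℓ
  _→v_ = ContextClosure.Closure Term VCtx plugV (_↦dB_ ∪ _↦sv_)

module Target where

  infixl 7 _·_
  infix  6 ƛ_
  infix  8 !_
  infixl 9 _[↦_]

  data Term (n : ℕ) : Set where
    var   : Fin n → Term n
    _·_   : Term n → Term n → Term n
    ƛ_    : Term (suc n) → Term n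
    !_    : Term n → Term n
    der   : Term n → Term n
    _[↦_] : Term (suc n) → Term n → Term n

  module _ {T : ℕ → Set} (l : Lift T Term) where
    open Lift l using (_↑; lift)

    apply : Term m → Sub T m n → Term n
    apply (var x)    ρ = lift (lookup ρ x)
    apply (t · u)    ρ = apply t ρ · apply u ρ
    apply (ƛ t)      ρ = ƛ apply t (ρ ↑)
    apply (! t)      ρ = ! apply t ρ
    apply (der t)    ρ = der (apply t ρ)
    apply (t [↦ u ]) ρ = apply t (ρ ↑) [↦ apply u ρ ]

  termSubst : TermSubst Term
  termSubst = record { var = var ; app = apply }

  open TermSubst termSubst public using (_/Var_; _/_; sub)

  open ListContexts Term _[↦_] public

  infix 4 _↦dB_ _↦s!_ _↦d!_ _→w_

  data _↦dB_ {n} : Rel (Term n) 0ℓ where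
    dB : ∀ {m} (L : LCtx n m) (t : Term (suc m)) (u : Term n) →
         L ⟨ ƛ t ⟩ · u ↦dB L ⟨ t [↦ u /Var shift L ] ⟩

  data _↦s!_ {n} : Rel (Term n) 0ℓ where
    s! : ∀ {m} (t : Term (suc n)) (L : LCtx n m) (u : Term m) →
         t [↦ L ⟨ ! u ⟩ ] ↦s! L ⟨ (t /Var (shift L VarSubst.↑)) / sub u ⟩

  data _↦d!_ {n} : Rel (Term n) 0ℓ where
    d! : ∀ {m} (L : LCtx n m) (t : Term m) → der (L ⟨ ! t ⟩) ↦d! L ⟨ t ⟩

  data WCtx : ℕ → ℕ → Set where
    □      : WCtx n n
    _·ˡ_   : WCtx n m → Term n → WCtx n m
    _·ʳ_   : Term n → WCtx n m → WCtx n m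
    ƛ_     : WCtx (suc n) m → WCtx n m
    der    : WCtx n m → WCtx n m
    _[↦_]ˡ : WCtx (suc n) m → Term n → WCtx n m
    _[↦_]ʳ : Term (suc n) → WCtx n m → WCtx n m

  plugW : WCtx n m → Term m → Term n
  plugW □           t = t
  plugW (W ·ˡ u)    t = plugW W t · u
  plugW (u ·ʳ W)    t = u · plugW W t
  plugW (ƛ W)       t = ƛ plugW W t
  plugW (der W)     t = der (plugW W t)
  plugW (W [↦ u ]ˡ) t = plugW W t [↦ u ]
  plugW (u [↦ W ]ʳ) t = u [↦ plugW W t ]

  _→w_ : Rel (Term n) 0ℓ
  _→w_ = ContextClosure.Closure Term WCtx plugW (_↦dB_ ∪ (_↦s!_ ∪ _↦d!_))

  data Banged {n} (t : Term n) : Set where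
    banged : ∀ {m} (L : LCtx n m) (s : Term m) → t ≡ L ⟨ ! s ⟩ → Banged t

  banged? : (t : Term n) → Dec (Banged t)
  banged? (var x) = no λ { (banged □ _ ()) ; (banged (_ [↦ _ ]) _ ()) }
  banged? (t · u) = no λ { (banged □ _ ()) ; (banged (_ [↦ _ ]) _ ()) }
  banged? (ƛ t)   = no λ { (banged □ _ ()) ; (banged (_ [↦ _ ]) _ ()) }
  banged? (der t) = no λ { (banged □ _ ()) ; (banged (_ [↦ _ ]) _ ()) }
  banged? (! t)   = yes (banged □ t refl)
  banged? (t [↦ u ]) with banged? t
  ... | yes (banged L s eq) = yes (banged (L [↦ u ]) s (cong _[↦ u ] eq))
  ... | no ¬b = no λ { (banged □ _ ())
                     ; (banged (L [↦ _ ]) s refl) → ¬b (banged L s refl) }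

open Target using (var; _·_; ƛ_; !_; der; _[↦_]; _⟨_⟩; banged; banged?)

cbn : Source.Term n → Target.Term n
cbn (Source.var x)      = var x
cbn (Source.ƛ t)        = ƛ cbn t
cbn (t Source.· u)      = cbn t · (! cbn u)
cbn (t Source.[↦ u ])   = cbn t [↦ ! cbn u ]

-- A term has at most one decomposition L ⟨ ! s ⟩, so the one returned by
-- banged? is immaterial.
cbvApp : Target.Term n → Target.Term n → Target.Term n
cbvApp t u with banged? t
... | yes (banged L s _) = L ⟨ s ⟩ · u
... | no _               = der t · u

cbv : Source.Term n → Target.Term n
cbv (Source.var x)      = ! var x
cbv (Source.ƛ t)        = ! (ƛ cbv t)
cbv (t Source.· u)      = cbvApp (cbv t) (cbv u)
cbv (t Source.[↦ u ])   = cbv t [↦ cbv u ]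

{-# OPTIONS --safe #-}
-- Weak normality in the target is a local condition on subterms outside bangs:
-- no applied L⟨ƛ s⟩, and no L⟨! s⟩ under der or as the argument of an explicit
-- substitution.  Both embeddings put a bang exactly around the subterms which
-- the source contexts do not enter, so it suffices that these shapes already
-- come from the source: L⟨! s⟩ from an L⟨v⟩, and an applied L⟨ƛ s⟩ from an
-- applied L⟨ƛ t⟩.  In call-by-value, if the function part of a v-normal
-- application translates to L⟨! s⟩, then s is a variable, so removing the bang
-- creates no redex.
module Submission where

open import Defs
open import Data.Nat.Base using (ℕ; suc)
open import Data.Product.Base using (_×_; _,_; ∃)
open import Data.Sum.Base using (inj₁; inj₂)
open import Relation.Binary.PropositionalEquality using (_≡_; refl)
open import Relation.Binary.Rewriting using (IsNormalForm)
open import Relation.Nullary using (¬_; yes; no; contradiction)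

open ContextClosure using (close)
open Target using (Banged; banged; banged?; !_)

private
  variable
    m n : ℕ

module WeakNormal where
  open Target

  data Abs (t : Term n) : Set where
    abs : (L : LCtx n m) (s : Term (suc m)) → t ≡ L ⟨ ƛ s ⟩ → Abs t

  data WNormal {n} : Term n → Set where
    var   : ∀ x → WNormal (var x)
    app   : ∀ {t u} → WNormal t → ¬ Abs t → WNormal u → WNormal (t · u)
    ƛ_    : ∀ {t} → WNormal t → WNormal (ƛ t)
    bang  : ∀ t → WNormal (! t)
    der   : ∀ {t} → WNormal t → ¬ Banged t → WNormal (der t)
    subst : ∀ {t u} → WNormal t → WNormal u → ¬ Banged u → WNormal (t [↦ u ])

  WNormal-unplug : (W : WCtx n m) {t : Term m} → WNormal (plugW W t) → WNormal t
  WNormal-unplug □           p             = p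
  WNormal-unplug (W ·ˡ u)    (app p _ _)   = WNormal-unplug W p
  WNormal-unplug (u ·ʳ W)    (app _ _ p)   = WNormal-unplug W p
  WNormal-unplug (ƛ W)       (ƛ p)         = WNormal-unplug W p
  WNormal-unplug (der W)     (der p _)     = WNormal-unplug W p
  WNormal-unplug (W [↦ u ]ˡ) (subst p _ _) = WNormal-unplug W p
  WNormal-unplug (u [↦ W ]ʳ) (subst _ p _) = WNormal-unplug W p

  -- A redex sits in a weak context, so it inherits `WNormal`; but the left-hand side of each rule
  -- violates the side condition of its outermost constructor.
  WNormal⇒IsNormalForm : {t : Term n} → WNormal t → IsNormalForm _→w_ t
  WNormal⇒IsNormalForm p (_ , close W r) with WNormal-unplug W p
  WNormal⇒IsNormalForm p (_ , close W (inj₁ (dB L t u))) | app _ ¬a _ =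
    ¬a (abs L t refl)
  WNormal⇒IsNormalForm p (_ , close W (inj₂ (inj₁ (s! t L u)))) | subst _ _ ¬b =
    ¬b (banged L u refl)
  WNormal⇒IsNormalForm p (_ , close W (inj₂ (inj₂ (d! L t)))) | der _ ¬b =
    ¬b (banged L t refl)

  Banged-[↦] : {t : Term (suc n)} {u : Term n} → Banged (t [↦ u ]) → Banged t
  Banged-[↦] (banged □ _ ())
  Banged-[↦] (banged (L [↦ _ ]) s refl) = banged L s refl

  [↦]-injectiveˡ : {t t′ : Term (suc n)} {u u′ : Term n} → t [↦ u ] ≡ t′ [↦ u′ ] → t ≡ t′
  [↦]-injectiveˡ refl = refl

  ¬Abs-⟨var⟩ : ∀ (L : LCtx n m) {x} → ¬ Abs (L ⟨ var x ⟩)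
  ¬Abs-⟨var⟩ □          (abs □ _ ())
  ¬Abs-⟨var⟩ □          (abs (_ [↦ _ ]) _ ())
  ¬Abs-⟨var⟩ (L [↦ u ]) (abs □ _ ())
  ¬Abs-⟨var⟩ (L [↦ u ]) (abs (L′ [↦ _ ]) s eq) = ¬Abs-⟨var⟩ L (abs L′ s ([↦]-injectiveˡ eq))

  -- Normality of `L ⟨ s ⟩` supplies the conditions on the arguments in `L`, and these do not depend
  -- on what fills the hole.
  WNormal-⟨⟩ : (L : LCtx n m) {s t : Term m} →
               WNormal t → WNormal (L ⟨ s ⟩) → WNormal (L ⟨ t ⟩)
  WNormal-⟨⟩ □          q _               = q
  WNormal-⟨⟩ (L [↦ u ]) q (subst p p′ ¬b) = subst (WNormal-⟨⟩ L q p) p′ ¬b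

  ¬Abs-der : {t : Term n} → ¬ Abs (der t)
  ¬Abs-der (abs □ _ ())
  ¬Abs-der (abs (_ [↦ _ ]) _ ())

  ¬Banged-· : {t u : Term n} → ¬ Banged (t · u)
  ¬Banged-· (banged □ _ ())
  ¬Banged-· (banged (_ [↦ _ ]) _ ())

open WeakNormal

module CallByName where
  open Source

  -- The hypothesis is on `t · u` because an abstraction makes a `dB`-redex only once applied. An
  -- explicit substitution in function position is already an `s`-redex.
  ¬Abs-cbn : (t : Term n) {u : Term n} → IsNormalForm _→n_ (t · u) → ¬ Abs (cbn t)
  ¬Abs-cbn (var x)    nf (abs Target.□ _ ())
  ¬Abs-cbn (var x)    nf (abs (_ Target.[↦ _ ]) _ ())
  ¬Abs-cbn (ƛ t)      nf _ = nf (_ , close □ (inj₁ (dB □ t _)))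
  ¬Abs-cbn (t · u)    nf (abs Target.□ _ ())
  ¬Abs-cbn (t · u)    nf (abs (_ Target.[↦ _ ]) _ ())
  ¬Abs-cbn (t [↦ u ]) nf _ = nf (_ , close (□ · _) (inj₂ (s t u)))

  cbn-WNormal : (t : Term n) → IsNormalForm _→n_ t → WNormal (cbn t)
  cbn-WNormal (var x)    nf = var x
  cbn-WNormal (ƛ t)      nf =
    ƛ cbn-WNormal t λ { (_ , close N r) → nf (_ , close (ƛ N) r) }
  cbn-WNormal (t · u)    nf =
    app (cbn-WNormal t λ { (_ , close N r) → nf (_ , close (N · u) r) })
        (¬Abs-cbn t nf)
        (bang (cbn u))
  cbn-WNormal (t [↦ u ]) nf = contradiction (_ , close □ (inj₂ (s t u))) nf

module CallByValue where
  open Source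

  data Answer (t : Term n) : Set where
    answer : (L : LCtx n m) {v : Term m} → Value v → t ≡ L ⟨ v ⟩ → Answer t

  ¬Banged-cbvApp : (t u : Target.Term n) → ¬ Banged (cbvApp t u)
  ¬Banged-cbvApp t u b with banged? t
  ... | yes (banged _ _ _) = ¬Banged-· b
  ... | no _               = ¬Banged-· b

  -- Applications translate to applications, so peeling off explicit substitutions from a banged
  -- translation must end at a value.
  Banged-cbv⇒Answer : (t : Term n) → Banged (cbv t) → Answer t
  Banged-cbv⇒Answer (var x)    b = answer □ (var x) refl
  Banged-cbv⇒Answer (ƛ t)      b = answer □ (ƛ t) refl
  Banged-cbv⇒Answer (t · u)    b = contradiction b (¬Banged-cbvApp (cbv t) (cbv u))
  Banged-cbv⇒Answer (t [↦ u ]) b with Banged-cbv⇒Answer t (Banged-[↦] b)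
  ... | answer L v refl = answer (L [↦ u ]) v refl

  -- Both list contexts are peeled in parallel down to `! var x`. The variable is existential
  -- because the scopes `m` and `k` are identified only there.
  cbv-⟨var⟩-body : ∀ {k} (L : LCtx n m) {x} (L′ : Target.LCtx n k) {s : Target.Term k} →
                   cbv (L ⟨ var x ⟩) ≡ L′ Target.⟨ ! s ⟩ → ∃ λ y → s ≡ Target.var y
  cbv-⟨var⟩-body □          Target.□ refl = _ , refl
  cbv-⟨var⟩-body □          (_ Target.[↦ _ ]) ()
  cbv-⟨var⟩-body (L [↦ u ]) Target.□ ()
  cbv-⟨var⟩-body (L [↦ u ]) (L′ Target.[↦ _ ]) eq = cbv-⟨var⟩-body L L′ ([↦]-injectiveˡ eq)

  cbvApp-WNormal : (t u : Term n) → IsNormalForm _→v_ (t · u) →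
                   WNormal (cbv t) → WNormal (cbv u) → WNormal (cbvApp (cbv t) (cbv u))
  cbvApp-WNormal t u nf p q with banged? (cbv t)
  ... | no ¬b = app (der p ¬b) ¬Abs-der q
  ... | yes b@(banged L _ eq) with Banged-cbv⇒Answer t b
  ...   | answer L′ (ƛ r) refl =
    contradiction (_ , close □ (inj₁ (dB L′ r u))) nf
  ...   | answer L′ (var x) refl with cbv-⟨var⟩-body L′ L eq
  -- Rewriting makes `p` the normality of `L ⟨ ! var y ⟩`; without the bang, the function part is a
  -- variable under `L`, so it is no abstraction.
  ...     | y , refl rewrite eq = app (WNormal-⟨⟩ L (var y) p) (¬Abs-⟨var⟩ L) q

  cbv-WNormal : (t : Term n) → IsNormalForm _→v_ t → WNormal (cbv t)
  cbv-WNormal (var x)    nf = bang _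
  cbv-WNormal (ƛ t)      nf = bang _
  cbv-WNormal (t · u)    nf = cbvApp-WNormal t u nf
    (cbv-WNormal t λ { (_ , close V r) → nf (_ , close (V ·ˡ u) r) })
    (cbv-WNormal u λ { (_ , close V r) → nf (_ , close (t ·ʳ V) r) })
  cbv-WNormal (t [↦ u ]) nf = subst
    (cbv-WNormal t λ { (_ , close V r) → nf (_ , close (V [↦ u ]ˡ) r) })
    (cbv-WNormal u λ { (_ , close V r) → nf (_ , close (t [↦ V ]ʳ) r) })
    ¬b
    where
    ¬b : ¬ Banged (cbv u)
    ¬b b with Banged-cbv⇒Answer u b
    -- An answer as argument makes the whole term an `sv`-redex.
    ... | answer L v refl = nf (_ , close □ (inj₂ (sv t L v)))

lemma4p4 : (n : ℕ) (t : Source.Term n) →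
    (IsNormalForm Source._→n_ t → IsNormalForm Target._→w_ (cbn t))
    × (IsNormalForm Source._→v_ t → IsNormalForm Target._→w_ (cbv t))
lemma4p4 n t = (λ nf → WNormal⇒IsNormalForm (CallByName.cbn-WNormal t nf))
             , (λ nf → WNormal⇒IsNormalForm (CallByValue.cbv-WNormal t nf))
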